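{- For all positive integers $a,b$, the complete bipartite graph $K_{a,b}$ satisfies $$M(K_{a,b})=a+b+\binom{a}{2}+\binom{b}{2}.$$
   Context: Graphs are finite, simple and undirected. $K_{a,b}$ is the complete bipartite graph with vertex classes $A=\{1,\dots,a\}$ and $B=\{a+1,\dots,a+b\}$ and edge set $\{\{\alpha,\beta\} : \alpha\in A,\beta\in B\}$. For a graph $\mathcal{G}$ with $n$ vertices and adjacency matrix $A$, viewed over $\mathbb{F}_2$, let $C(\mathcal{G})\subseteq\mathbb{F}_2^{2n}$ be the binary linear code generated by the rows of $[I_n|A]$, where $I_n$ is the $n\times n$ identity matrix. The support of a vector is the set of positions of its nonzero entries. A nonzero codeword $c$ of a binary linear code $C$ is minimal if there is no nonzero codeword $c'\in C$ with $\operatorname{supp}(c')\subsetneq\operatorname{supp}(c)$. $M(\mathcal{G})$ denotes the number of minimal codewords of $C(\mathcal{G})$; it does not depend on the labeling of the vertices. -}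

module Defs where

open import Data.Bool.Base using (if_then_else_)
open import Data.Fin.Base using (Fin; toℕ)
import Data.Fin.Properties as Fin
open import Data.Fin.Subset using (Subset; _⊂_)
open import Data.Fin.Subset.Properties using (_⊂?_)
open import Data.List.Base using (List; []; _∷_; [_]; length; filter; cartesianProductWith)
open import Data.List.Membership.Propositional using (_∈_; lose)
open import Data.List.Membership.Propositional.Properties using (∈-cartesianProductWith⁺)
open import Data.List.Relation.Unary.All using ([]; _∷_)
open import Data.List.Relation.Unary.Any using (here; there; any?; satisfied)
open import Data.List.Relation.Unary.AllPairs using ([]; _∷_)
open import Data.List.Relation.Unary.Unique.Propositional using (Unique)
open import Data.List.Relation.Unary.Unique.Propositional.Properties
  using (cartesianProductWith⁺)
open import Data.Nat.Base using (ℕ; zero; suc; _+_; _≤_; _<_)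
import Data.Nat.Properties as ℕ
open import Data.Parity.Base using (Parity; 0ℙ; 1ℙ) renaming (_*_ to _·_)
import Data.Parity.Properties as ℙ
open import Data.Product.Base using (∃; _×_; _,_)
open import Data.Sum.Base using (_⊎_; inj₁; inj₂)
open import Data.Vec.Base using (Vec; []; _∷_; map; lookup; replicate; tabulate)
open import Data.Vec.Properties using (≡-dec; ∷-injective)
import Data.Vec.Functional as F
open import Relation.Binary.Definitions using (Decidable; Symmetric; Irreflexive)
open import Relation.Binary.PropositionalEquality using (_≡_; _≢_; refl)
open import Relation.Nullary.Decidable using (Dec; does; map′; ¬?; _×-dec_; _⊎-dec_)
open import Relation.Nullary.Negation using (¬_)
import Relation.Unary as U

open import Algebra.Properties.Semiring.Sum ℙ.+-*-semiring using (sum)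

------------------------------------------------------------------------
-- Graphs

-- Adjacency is required to be decidable so that the adjacency matrix can be
-- computed.
record Graph (n : ℕ) : Set₁ where
  field
    Adj    : Fin n → Fin n → Set
    adj?   : Decidable Adj
    sym    : Symmetric Adj
    irrefl : Irreflexive _≡_ Adj

-- Vertices are counted from 0: the classes are {0,…,a-1} and {a,…,a+b-1}.
module _ (a b : ℕ) where

  InA InB : Fin (a + b) → Set
  InA v = toℕ v < a
  InB v = a ≤ toℕ v

  private
    Edge : Fin (a + b) → Fin (a + b) → Set
    Edge u v = (InA u × InB v) ⊎ (InB u × InA v)

    edge? : Decidable Edge
    edge? u v = ((toℕ u ℕ.<? a) ×-dec (a ℕ.≤? toℕ v))
          ⊎-dec ((a ℕ.≤? toℕ u) ×-dec (toℕ v ℕ.<? a))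

    edge-sym : Symmetric Edge
    edge-sym (inj₁ (p , q)) = inj₂ (q , p)
    edge-sym (inj₂ (p , q)) = inj₁ (q , p)

    edge-irrefl : Irreflexive _≡_ Edge
    edge-irrefl refl (inj₁ (p , q)) = ℕ.<⇒≱ p q
    edge-irrefl refl (inj₂ (p , q)) = ℕ.<⇒≱ q p

  K : Graph (a + b)
  K = record { Adj = Edge ; adj? = edge? ; sym = edge-sym ; irrefl = edge-irrefl }

------------------------------------------------------------------------
-- Words and matrices over 𝔽₂, realised as the ring Parity

𝔽₂ : Set
𝔽₂ = Parity

Word : ℕ → Set
Word = Vec 𝔽₂

Matrix : ℕ → ℕ → Set
Matrix k m = Fin k → Fin m → 𝔽₂

𝟎 : ∀ {m} → Word m
𝟎 = replicate _ 0ℙ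

supp : ∀ {m} → Word m → Subset m
supp = map (λ x → does (¬? (x ℙ.≟ 0ℙ)))

words : ∀ m → List (Word m)
words zero    = [ [] ]
words (suc m) = cartesianProductWith _∷_ (0ℙ ∷ 1ℙ ∷ []) (words m)

words-complete : ∀ {m} (w : Word m) → w ∈ words m
words-complete []      = here refl
words-complete (x ∷ w) = ∈-cartesianProductWith⁺ _∷_ (bit x) (words-complete w)
  where
  bit : ∀ x → x ∈ 0ℙ ∷ 1ℙ ∷ []
  bit 0ℙ = here refl
  bit 1ℙ = there (here refl)

words-unique : ∀ m → Unique (words m)
words-unique zero    = [] ∷ []
words-unique (suc m) =
  cartesianProductWith⁺ _∷_ ∷-injective (((λ ()) ∷ []) ∷ [] ∷ []) (words-unique m)

∃word? : ∀ {m p} {P : Word m → Set p} → U.Decidable P → Dec (∃ P)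
∃word? P? = map′ satisfied (λ (w , Pw) → lose (words-complete w) Pw) (any? P? (words _))

------------------------------------------------------------------------
-- Binary linear codes

_≟ʷ_ : ∀ {m} → Decidable {A = Word m} _≡_
_≟ʷ_ = ≡-dec ℙ._≟_

combination : ∀ {k m} → Matrix k m → Word k → Word m
combination G x = tabulate λ j → sum λ i → lookup x i · G i j

-- c lies in the code generated by the rows of G.
_∈Code_ : ∀ {k m} → Word m → Matrix k m → Set
c ∈Code G = ∃ λ x → c ≡ combination G x

_∈Code?_ : ∀ {k m} → Decidable (_∈Code_ {k} {m})
c ∈Code? G = ∃word? λ x → c ≟ʷ combination G x

NonzeroCodeword : ∀ {k m} → Matrix k m → Word m → Set
NonzeroCodeword G c = c ∈Code G × c ≢ 𝟎

nonzeroCodeword? : ∀ {k m} (G : Matrix k m) → U.Decidable (NonzeroCodeword G)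
nonzeroCodeword? G c = (c ∈Code? G) ×-dec ¬? (c ≟ʷ 𝟎)

Minimal : ∀ {k m} → Matrix k m → Word m → Set
Minimal G c =
  NonzeroCodeword G c × ¬ ∃ λ c′ → NonzeroCodeword G c′ × supp c′ ⊂ supp c

minimal? : ∀ {k m} (G : Matrix k m) → U.Decidable (Minimal G)
minimal? G c =
  nonzeroCodeword? G c
    ×-dec ¬? (∃word? λ c′ → nonzeroCodeword? G c′ ×-dec (supp c′ ⊂? supp c))

------------------------------------------------------------------------
-- The code of a graph

identity : ∀ n → Matrix n n
identity n i j = if does (i Fin.≟ j) then 1ℙ else 0ℙ

adjacency : ∀ {n} → Graph n → Matrix n n
adjacency 𝒢 i j = if does (Graph.adj? 𝒢 i j) then 1ℙ else 0ℙ

[I∣A] : ∀ {n} → Graph n → Matrix n (n + n)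
[I∣A] {n} 𝒢 i = identity n i F.++ adjacency 𝒢 i

-- The number of minimal codewords of the code generated by [I|A]; words lists
-- each vector exactly once, by words-complete and words-unique.
M : ∀ {n} → Graph n → ℕ
M 𝒢 = length (filter (minimal? ([I∣A] 𝒢)) (words _))

{-# OPTIONS --safe #-}
module Submission where

-- Split a message of length a + b as u ++ v along the two classes of K a b.
-- A vertex of the first class is adjacent to exactly the second class, and
-- conversely, so u ++ v is encoded as the message itself, followed by a copies
-- of the parity of v and b copies of the parity of u (combination-K).  As a and
-- b are positive, the support of the codeword of (u′ , v′) is contained in that
-- of (u , v) if and only if u′ ⊴ u and v′ ⊴ v, where u′ ⊴ u means that u′ lies
-- below u coordinatewise and that the parity of u′ is at most that of u
-- (encode-mono, encode-mono⁻).  Hence a codeword is minimal if and only if one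
-- of u, v is zero and the other is a minimal nonzero word for ⊴.
--
-- The minimal nonzero words for ⊴ are those of weight 1 or 2, here called
-- light.  A nonzero word strictly below a light one coordinatewise has weight 1
-- and lies under a word of weight 2, against the parity condition
-- (light-minimal).
-- Conversely, a word of weight 1 is light itself, and any heavier word lies
-- above a word of weight 2, whose parity is 0 (light-below).
--
-- There are n + n C 2 light words of length n, whence the formula.

open import Algebra.Properties.CommutativeSemigroup using (interchange)
open import Algebra.Properties.Semiring.Sum using (sum; sum-cong-≗; sum-replicate-zero)
open import Data.Bool.Base using (true; false; if_then_else_)
open import Data.Fin.Base using (Fin; zero; suc; toℕ; _↑ˡ_; _↑ʳ_)
open import Data.Fin.Properties using (toℕ-↑ˡ; toℕ-↑ʳ; toℕ<n)
open import Data.Fin.Subset using (∣_∣; _⊆_; _⊂_)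
open import Data.Fin.Subset.Properties
  using (drop-∷-⊆; out⊆; s⊆s; s⊂s; out⊂in; ⊂-irref; p⊆q⇒∣p∣≤∣q∣; p⊂q⇒∣p∣<∣q∣)
open import Data.List.Base as List using (List; length; filter)
open import Data.List.Membership.Propositional using (_∈_)
open import Data.List.Membership.Propositional.Properties
  using (∈-filter⁺; ∈-filter⁻; ∈-map⁺; ∈-map⁻; ∈-++⁺ˡ; ∈-++⁺ʳ; ∈-++⁻)
open import Data.List.Membership.Propositional.Properties.WithK using (unique∧set⇒bag)
open import Data.List.Properties
  using (filter-++; filter-≐; filter-none; length-++; length-map; ++-identityʳ)
open import Data.List.Relation.Binary.BagAndSetEquality using (∼bag⇒↭)
open import Data.List.Relation.Binary.Permutation.Propositional.Properties using (↭-length)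
import Data.List.Relation.Unary.All as All
open import Data.List.Relation.Unary.Unique.Propositional using (Unique)
import Data.List.Relation.Unary.Unique.Propositional.Properties as Unique
open import Data.Nat.Base using (ℕ; zero; suc; _+_; _≤_; z≤n; s≤s; s≤s⁻¹; parity; NonZero)
open import Data.Nat.Combinatorics using (_C_; nC1≡n; nCk+nC[k+1]≡[n+1]C[k+1])
import Data.Nat.Properties as ℕ
open import Data.Parity.Base as ℙ using (0ℙ; 1ℙ)
import Data.Parity.Properties as ℙ
open import Data.Product.Base using (∃; _×_; _,_; proj₁; proj₂)
open import Data.Sum.Base using (_⊎_; inj₁; inj₂)
open import Data.Vec.Base using ([]; _∷_; _++_; lookup; replicate; tabulate; splitAt; here)
open import Data.Vec.Properties
  using (lookup-++ˡ; lookup-++ʳ; tabulate∘lookup; tabulate-cong; ++-injective; ++-injectiveˡ)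
import Data.Vec.Functional.Properties as Functional
open import Data.Vec.Relation.Binary.Pointwise.Inductive as Pointwise using (Pointwise; []; _∷_)
open import Function.Base using (_∘_)
open import Function.Bundles using (mk⇔)
open import Relation.Binary.PropositionalEquality
  using (_≡_; _≢_; refl; sym; trans; cong; cong₂; subst; module ≡-Reasoning)
open import Relation.Nullary.Decidable using (yes; no; does; dec-true; dec-false)
open import Relation.Nullary.Negation using (¬_; contradiction)
open import Relation.Unary using (Pred; Decidable)
open import Defs

open ≡-Reasoning

private
  variable
    m n : ℕ

-- Summation in 𝔽₂.
∑ : (Fin n → 𝔽₂) → 𝔽₂
∑ = sum ℙ.+-*-semiring

------------------------------------------------------------------------
-- The coordinatewise order on words

-- The order 0 < 1 on 𝔽₂.
data _≤₂_ : 𝔽₂ → 𝔽₂ → Set where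
  0≤  : ∀ {x} → 0ℙ ≤₂ x
  1≤1 : 1ℙ ≤₂ 1ℙ

≤₂-refl : ∀ {x} → x ≤₂ x
≤₂-refl {0ℙ} = 0≤
≤₂-refl {1ℙ} = 1≤1

-- Containment of supports, see ≼⇒supp⊆ and supp⊆⇒≼.
_≼_ : Word m → Word m → Set
_≼_ = Pointwise _≤₂_

≼-refl : {w : Word m} → w ≼ w
≼-refl = Pointwise.refl ≤₂-refl

𝟎-≼ : {w : Word m} → 𝟎 ≼ w
𝟎-≼ {w = []}    = []
𝟎-≼ {w = _ ∷ _} = 0≤ ∷ 𝟎-≼

≼𝟎⇒≡𝟎 : {w : Word m} → w ≼ 𝟎 → w ≡ 𝟎
≼𝟎⇒≡𝟎 []       = refl
≼𝟎⇒≡𝟎 (0≤ ∷ p) = cong (0ℙ ∷_) (≼𝟎⇒≡𝟎 p)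

replicate-mono : ∀ {x y} → x ≤₂ y → replicate m x ≼ replicate m y
replicate-mono {zero}  x≤y = []
replicate-mono {suc m} x≤y = x≤y ∷ replicate-mono x≤y

replicate-mono⁻ : .{{_ : NonZero m}} → ∀ {x y} → replicate m x ≼ replicate m y → x ≤₂ y
replicate-mono⁻ {suc m} (x≤y ∷ _) = x≤y

≼⇒supp⊆ : {c d : Word m} → c ≼ d → supp c ⊆ supp d
≼⇒supp⊆ []        = λ ()
≼⇒supp⊆ (0≤  ∷ p) = out⊆ (≼⇒supp⊆ p)
≼⇒supp⊆ (1≤1 ∷ p) = s⊆s (≼⇒supp⊆ p)

supp⊆⇒≼ : (c d : Word m) → supp c ⊆ supp d → c ≼ d
supp⊆⇒≼ []       []       p = []
supp⊆⇒≼ (0ℙ ∷ c) (x ∷ d)  p = 0≤ ∷ supp⊆⇒≼ c d (drop-∷-⊆ p)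
supp⊆⇒≼ (1ℙ ∷ c) (1ℙ ∷ d) p = 1≤1 ∷ supp⊆⇒≼ c d (drop-∷-⊆ p)
supp⊆⇒≼ (1ℙ ∷ c) (0ℙ ∷ d) p with () ← p here

≼∧≢⇒supp⊂ : {c d : Word m} → c ≼ d → c ≢ d → supp c ⊂ supp d
≼∧≢⇒supp⊂ []                  c≢d = contradiction refl c≢d
≼∧≢⇒supp⊂ (0≤ {x = 0ℙ} ∷ p) c≢d = s⊂s (≼∧≢⇒supp⊂ p (c≢d ∘ cong (0ℙ ∷_)))
≼∧≢⇒supp⊂ (0≤ {x = 1ℙ} ∷ p) c≢d = out⊂in (≼⇒supp⊆ p)
≼∧≢⇒supp⊂ (1≤1 ∷ p)           c≢d = s⊂s (≼∧≢⇒supp⊂ p (c≢d ∘ cong (1ℙ ∷_)))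

------------------------------------------------------------------------
-- Weight and parity

-- The Hamming weight.
weight : Word m → ℕ
weight w = ∣ supp w ∣

-- The parity of a word: the sum of its entries, see ∑-lookup.
π : Word m → 𝔽₂
π w = parity (weight w)

weight-𝟎 : ∀ m → weight (𝟎 {m}) ≡ 0
weight-𝟎 zero    = refl
weight-𝟎 (suc m) = weight-𝟎 m

π-𝟎 : ∀ m → π (𝟎 {m}) ≡ 0ℙ
π-𝟎 m = cong parity (weight-𝟎 m)

weight≡0⇒≡𝟎 : (w : Word m) → weight w ≡ 0 → w ≡ 𝟎
weight≡0⇒≡𝟎 []       _  = refl
weight≡0⇒≡𝟎 (0ℙ ∷ w) eq = cong (0ℙ ∷_) (weight≡0⇒≡𝟎 w eq)

weight≡suc⇒≢𝟎 : ∀ {k} {w : Word m} → weight w ≡ suc k → w ≢ 𝟎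
weight≡suc⇒≢𝟎 {m} eq refl with () ← trans (sym (weight-𝟎 m)) eq

∑-lookup : (w : Word m) → ∑ (lookup w) ≡ π w
∑-lookup []       = refl
∑-lookup (0ℙ ∷ w) = ∑-lookup w
∑-lookup (1ℙ ∷ w) = trans (cong ℙ._⁻¹ (∑-lookup w)) (sym (ℙ.+-homo-+ 1 (weight w)))

-- Ones can be deleted from a word until any prescribed smaller weight is left.
subword : ∀ k (w : Word m) → k ≤ weight w → ∃ λ u → u ≼ w × weight u ≡ k
subword {m} zero w _ = 𝟎 , 𝟎-≼ , weight-𝟎 m
subword (suc k) (0ℙ ∷ w) k<w =
  let u , u≼w , eq = subword (suc k) w k<w in 0ℙ ∷ u , 0≤ ∷ u≼w , eq
subword (suc k) (1ℙ ∷ w) k<w =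
  let u , u≼w , eq = subword k w (s≤s⁻¹ k<w) in 1ℙ ∷ u , 1≤1 ∷ u≼w , cong suc eq

------------------------------------------------------------------------
-- Light words

-- The order that containment of supports of codewords induces on each half of a message.
_⊴_ : Word m → Word m → Set
u ⊴ w = u ≼ w × π u ≤₂ π w

⊴-refl : {w : Word m} → w ⊴ w
⊴-refl = ≼-refl , ≤₂-refl

𝟎-⊴ : {w : Word m} → 𝟎 ⊴ w
𝟎-⊴ {m} {w} = 𝟎-≼ , subst (_≤₂ π w) (sym (π-𝟎 m)) 0≤

-- The words that are minimal for ⊴ among the nonzero ones.
Light : Word m → Set
Light w = weight w ≡ 1 ⊎ weight w ≡ 2

light⇒≢𝟎 : {w : Word m} → Light w → w ≢ 𝟎
light⇒≢𝟎 (inj₁ eq) = weight≡suc⇒≢𝟎 eq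
light⇒≢𝟎 (inj₂ eq) = weight≡suc⇒≢𝟎 eq

light-minimal : {u w : Word m} → Light w → u ⊴ w → u ≢ 𝟎 → u ≡ w
light-minimal {u = u} {w} light (u≼w , πu≤πw) u≢𝟎 with u ≟ʷ w
... | yes u≡w = u≡w
... | no  u≢w = contradiction πu≤πw (¬πu≤πw light weight-u weight-u<weight-w)
  where
  weight-u : weight u ≢ 0
  weight-u = u≢𝟎 ∘ weight≡0⇒≡𝟎 u

  weight-u<weight-w : suc (weight u) ≤ weight w
  weight-u<weight-w = p⊂q⇒∣p∣<∣q∣ (≼∧≢⇒supp⊂ u≼w u≢w)

  -- Only weights 1 < 2 remain, and then the parities are 1 and 0.
  ¬πu≤πw : ∀ {j k} → k ≡ 1 ⊎ k ≡ 2 → j ≢ 0 → suc j ≤ k → ¬ parity j ≤₂ parity k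
  ¬πu≤πw {zero}        _           j≢0 _               = contradiction refl j≢0
  ¬πu≤πw {suc zero}    (inj₁ refl) _   (s≤s ())
  ¬πu≤πw {suc zero}    (inj₂ refl) _   _               = λ ()
  ¬πu≤πw {suc (suc j)} (inj₁ refl) _   (s≤s ())
  ¬πu≤πw {suc (suc j)} (inj₂ refl) _   (s≤s (s≤s ()))

light-below : {w : Word m} → w ≢ 𝟎 → ∃ λ u → Light u × u ⊴ w
light-below {w = w} w≢𝟎 with weight w in eq
... | 0           = contradiction (weight≡0⇒≡𝟎 w eq) w≢𝟎
... | 1           = w , inj₁ eq , ≼-refl , subst (λ k → π w ≤₂ parity k) eq ≤₂-refl
... | suc (suc k) =
  let u , u≼w , weight-u = subword 2 w (subst (2 ≤_) (sym eq) (s≤s (s≤s z≤n)))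
  in  u , inj₂ weight-u , u≼w , subst (λ j → parity j ≤₂ parity k) (sym weight-u) 0≤

------------------------------------------------------------------------
-- Counting light words

length-filter-map : ∀ {a b p} {A : Set a} {B : Set b} {P : Pred B p} (P? : Decidable P)
                    (f : A → B) xs →
                    length (filter P? (List.map f xs)) ≡ length (filter (P? ∘ f) xs)
length-filter-map P? f List.[]       = refl
length-filter-map P? f (x List.∷ xs) with does (P? (f x))
... | true  = cong suc (length-filter-map P? f xs)
... | false = length-filter-map P? f xs

hasWeight? : ∀ k → Decidable {A = Word m} (λ w → weight w ≡ k)
hasWeight? k w = weight w ℕ.≟ k

-- All words of length m and weight k.
ofWeight : ∀ m → ℕ → List (Word m)
ofWeight m k = filter (hasWeight? k) (words m)

length-ofWeight : ∀ m k → length (ofWeight m k) ≡ m C k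
length-ofWeight zero    zero    = refl
length-ofWeight zero    (suc k) = refl
length-ofWeight (suc m) k       = begin
  length (filter P? (zeros List.++ ones List.++ List.[]))
    ≡⟨ cong (λ xs → length (filter P? (zeros List.++ xs))) (++-identityʳ ones) ⟩
  length (filter P? (zeros List.++ ones))
    ≡⟨ cong length (filter-++ P? zeros ones) ⟩
  length (filter P? zeros List.++ filter P? ones)
    ≡⟨ length-++ (filter P? zeros) ⟩
  length (filter P? zeros) + length (filter P? ones)
    ≡⟨ cong₂ _+_ (length-filter-map P? (0ℙ ∷_) (words m)) (length-filter-map P? (1ℙ ∷_) (words m)) ⟩
  length (ofWeight m k) + length (filter (P? ∘ (1ℙ ∷_)) (words m))
    ≡⟨ pascal k ⟩
  suc m C k ∎
  where
  P? : Decidable (λ w → weight w ≡ k)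
  P? = hasWeight? k

  zeros ones : List (Word (suc m))
  zeros = List.map (0ℙ ∷_) (words m)
  ones  = List.map (1ℙ ∷_) (words m)

  -- Splitting by the first letter is Pascal's rule.
  pascal : ∀ k → length (ofWeight m k) + length (filter (hasWeight? k ∘ (1ℙ ∷_)) (words m))
               ≡ suc m C k
  pascal zero = cong₂ _+_ (length-ofWeight m 0)
    (cong length (filter-none (hasWeight? 0 ∘ (1ℙ ∷_)) (All.universal (λ _ ()) (words m))))
  pascal (suc k) = begin
    length (ofWeight m (suc k)) + length (filter (hasWeight? (suc k) ∘ (1ℙ ∷_)) (words m))
      ≡⟨ cong₂ _+_ (length-ofWeight m (suc k))
           (trans (cong length (filter-≐ _ (hasWeight? k) (ℕ.suc-injective , cong suc) (words m)))
                  (length-ofWeight m k)) ⟩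
    m C suc k + m C k
      ≡⟨ ℕ.+-comm (m C suc k) (m C k) ⟩
    m C k + m C suc k
      ≡⟨ nCk+nC[k+1]≡[n+1]C[k+1] m k ⟩
    suc m C suc k ∎

-- All light words of length m.
lights : ∀ m → List (Word m)
lights m = ofWeight m 1 List.++ ofWeight m 2

length-lights : ∀ m → length (lights m) ≡ m + m C 2
length-lights m = begin
  length (lights m)                                ≡⟨ length-++ (ofWeight m 1) ⟩
  length (ofWeight m 1) + length (ofWeight m 2)    ≡⟨ cong₂ _+_ (length-ofWeight m 1) (length-ofWeight m 2) ⟩
  m C 1 + m C 2                                    ≡⟨ cong (_+ m C 2) (nC1≡n m) ⟩
  m + m C 2                                        ∎

∈-ofWeight⁻ : ∀ k {w : Word m} → w ∈ ofWeight m k → weight w ≡ k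
∈-ofWeight⁻ k = proj₂ ∘ ∈-filter⁻ (hasWeight? k) {xs = words _}

∈-lights⁺ : {w : Word m} → Light w → w ∈ lights m
∈-lights⁺ (inj₁ eq) = ∈-++⁺ˡ (∈-filter⁺ (hasWeight? 1) (words-complete _) eq)
∈-lights⁺ (inj₂ eq) = ∈-++⁺ʳ (ofWeight _ 1) (∈-filter⁺ (hasWeight? 2) (words-complete _) eq)

∈-lights⁻ : {w : Word m} → w ∈ lights m → Light w
∈-lights⁻ {m} w∈ with ∈-++⁻ (ofWeight m 1) w∈
... | inj₁ w∈₁ = inj₁ (∈-ofWeight⁻ 1 w∈₁)
... | inj₂ w∈₂ = inj₂ (∈-ofWeight⁻ 2 w∈₂)

unique-lights : ∀ m → Unique (lights m)
unique-lights m = Unique.++⁺ (unique 1) (unique 2) λ (w∈₁ , w∈₂) →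
  contradiction (trans (sym (∈-ofWeight⁻ 1 w∈₁)) (∈-ofWeight⁻ 2 w∈₂)) λ ()
  where
  unique : ∀ k → Unique (ofWeight m k)
  unique k = Unique.filter⁺ (hasWeight? k) (words-unique m)

------------------------------------------------------------------------
-- Sums and tables over a disjoint union of index sets

∑-cong : {f g : Fin m → 𝔽₂} → (∀ i → f i ≡ g i) → ∑ f ≡ ∑ g
∑-cong = sum-cong-≗ ℙ.+-*-semiring

∑-++ : ∀ m (f : Fin (m + n) → 𝔽₂) → ∑ f ≡ ∑ (f ∘ (_↑ˡ n)) ℙ.+ ∑ (f ∘ (m ↑ʳ_))
∑-++ zero    f = refl
∑-++ (suc m) f = trans (cong (f zero ℙ.+_) (∑-++ m (f ∘ suc))) (sym (ℙ.+-assoc (f zero) _ _))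

tabulate-++ : ∀ m (f : Fin (m + n) → 𝔽₂) →
              tabulate f ≡ tabulate (f ∘ (_↑ˡ n)) ++ tabulate (f ∘ (m ↑ʳ_))
tabulate-++ zero    f = refl
tabulate-++ (suc m) f = cong (f zero ∷_) (tabulate-++ m (f ∘ suc))

tabulate-const : ∀ m {f : Fin m → 𝔽₂} {x} → (∀ i → f i ≡ x) → tabulate f ≡ replicate m x
tabulate-const zero    f≡x = refl
tabulate-const (suc m) f≡x = cong₂ _∷_ (f≡x zero) (tabulate-const m (f≡x ∘ suc))

𝟎-++-𝟎 : ∀ m {n} → 𝟎 {m} ++ 𝟎 {n} ≡ 𝟎
𝟎-++-𝟎 zero    = refl
𝟎-++-𝟎 (suc m) = cong (0ℙ ∷_) (𝟎-++-𝟎 m)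

-- The sum of a word against a constant row of zeros or of ones.
∑-·0 : (w : Word m) → ∑ (λ i → lookup w i ℙ.* 0ℙ) ≡ 0ℙ
∑-·0 {m} w = trans (∑-cong (λ i → ℙ.*-zeroʳ (lookup w i))) (sum-replicate-zero ℙ.+-*-semiring m)

∑-·1 : (w : Word m) → ∑ (λ i → lookup w i ℙ.* 1ℙ) ≡ π w
∑-·1 w = trans (∑-cong (λ i → ℙ.*-identityʳ (lookup w i))) (∑-lookup w)

∑-identity : (w : Word m) (j : Fin m) → ∑ (λ i → lookup w i ℙ.* identity m i j) ≡ lookup w j
∑-identity (x ∷ w) zero    = begin
  x ℙ.* 1ℙ ℙ.+ ∑ (λ i → lookup w i ℙ.* 0ℙ)  ≡⟨ cong₂ ℙ._+_ (ℙ.*-identityʳ x) (∑-·0 w) ⟩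
  x ℙ.+ 0ℙ                                  ≡⟨ ℙ.+-identityʳ x ⟩
  x                                         ∎
∑-identity (x ∷ w) (suc j) =
  cong₂ ℙ._+_ (ℙ.*-zeroʳ x) (∑-identity w j)

------------------------------------------------------------------------
-- The code of the complete bipartite graph

module _ (a b : ℕ) where

  -- The codeword of the message u ++ v, see combination-K.
  encode : Word a → Word b → Word ((a + b) + (a + b))
  encode u v = (u ++ v) ++ (replicate a (π v) ++ replicate b (π u))

  private
    A : Matrix (a + b) (a + b)
    A = adjacency (K a b)

    left  : Fin a → Fin (a + b)
    left  = _↑ˡ b

    right : Fin b → Fin (a + b)
    right = a ↑ʳ_

    left∈A : ∀ i → InA a b (left i)
    left∈A i = subst (λ k → suc k ≤ a) (sym (toℕ-↑ˡ i b)) (toℕ<n i)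

    right∈B : ∀ i → InB a b (right i)
    right∈B i = subst (a ≤_) (sym (toℕ-↑ʳ a i)) (ℕ.m≤m+n a (toℕ i))

    left∉B : ∀ i → ¬ InB a b (left i)
    left∉B i = ℕ.<⇒≱ (left∈A i)

    right∉A : ∀ i → ¬ InA a b (right i)
    right∉A i = ℕ.≤⇒≯ (right∈B i)

    adjacent : ∀ i j → Graph.Adj (K a b) i j → A i j ≡ 1ℙ
    adjacent i j e = cong (λ e → if e then 1ℙ else 0ℙ) (dec-true (Graph.adj? (K a b) i j) e)

    nonadjacent : ∀ i j → ¬ Graph.Adj (K a b) i j → A i j ≡ 0ℙ
    nonadjacent i j ¬e = cong (λ e → if e then 1ℙ else 0ℙ) (dec-false (Graph.adj? (K a b) i j) ¬e)

    A-left-left : ∀ i j → A (left i) (left j) ≡ 0ℙ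
    A-left-left i j = nonadjacent _ _ λ
      { (inj₁ (_ , j∈B)) → left∉B j j∈B
      ; (inj₂ (i∈B , _)) → left∉B i i∈B }

    A-right-right : ∀ i j → A (right i) (right j) ≡ 0ℙ
    A-right-right i j = nonadjacent _ _ λ
      { (inj₁ (i∈A , _)) → right∉A i i∈A
      ; (inj₂ (_ , j∈A)) → right∉A j j∈A }

    A-left-right : ∀ i j → A (left i) (right j) ≡ 1ℙ
    A-left-right i j = adjacent _ _ (inj₁ (left∈A i , right∈B j))

    A-right-left : ∀ i j → A (right i) (left j) ≡ 1ℙ
    A-right-left i j = adjacent _ _ (inj₂ (right∈B i , left∈A j))

    -- A column of the adjacency matrix is constant on each of the two classes.
    ∑-column : (u : Word a) (v : Word b) (j : Fin (a + b)) {x y : 𝔽₂} →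
               (∀ i → A (left i) j ≡ x) → (∀ i → A (right i) j ≡ y) →
               ∑ (λ i → lookup (u ++ v) i ℙ.* A i j)
                 ≡ ∑ (λ i → lookup u i ℙ.* x) ℙ.+ ∑ (λ i → lookup v i ℙ.* y)
    ∑-column u v j onA onB = trans (∑-++ a _) (cong₂ ℙ._+_
      (∑-cong λ i → cong₂ ℙ._*_ (lookup-++ˡ u v i) (onA i))
      (∑-cong λ i → cong₂ ℙ._*_ (lookup-++ʳ u v i) (onB i)))

    ∑-left : ∀ u v j → ∑ (λ i → lookup (u ++ v) i ℙ.* A i (left j)) ≡ π v
    ∑-left u v j = trans
      (∑-column u v (left j) (λ i → A-left-left i j) (λ i → A-right-left i j))
      (cong₂ ℙ._+_ (∑-·0 u) (∑-·1 v))

    ∑-right : ∀ u v j → ∑ (λ i → lookup (u ++ v) i ℙ.* A i (right j)) ≡ π u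
    ∑-right u v j = trans
      (∑-column u v (right j) (λ i → A-left-right i j) (λ i → A-right-right i j))
      (trans (cong₂ ℙ._+_ (∑-·1 u) (∑-·0 v)) (ℙ.+-identityʳ (π u)))

  combination-K : (u : Word a) (v : Word b) →
                  combination ([I∣A] (K a b)) (u ++ v) ≡ encode u v
  combination-K u v = begin
    tabulate (λ j → ∑ λ i → lookup w i ℙ.* [I∣A] (K a b) i j)
      ≡⟨ tabulate-++ (a + b) _ ⟩
    tabulate (λ j → ∑ λ i → lookup w i ℙ.* [I∣A] (K a b) i (j ↑ˡ (a + b)))
      ++ tabulate (λ j → ∑ λ i → lookup w i ℙ.* [I∣A] (K a b) i ((a + b) ↑ʳ j))
      ≡⟨ cong₂ _++_
           (tabulate-cong λ j → ∑-cong λ i → cong (lookup w i ℙ.*_)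
             (Functional.lookup-++ˡ (identity (a + b) i) (A i) j))
           (tabulate-cong λ j → ∑-cong λ i → cong (lookup w i ℙ.*_)
             (Functional.lookup-++ʳ (identity (a + b) i) (A i) j)) ⟩
    tabulate (λ j → ∑ λ i → lookup w i ℙ.* identity (a + b) i j)
      ++ tabulate (λ j → ∑ λ i → lookup w i ℙ.* A i j)
      ≡⟨ cong₂ _++_
           (trans (tabulate-cong (∑-identity w)) (tabulate∘lookup w))
           (trans (tabulate-++ a _)
             (cong₂ _++_ (tabulate-const a (∑-left u v)) (tabulate-const b (∑-right u v)))) ⟩
    encode u v ∎
    where
    w : Word (a + b)
    w = u ++ v

  encode-injective : (u u′ : Word a) (v v′ : Word b) →
                     encode u v ≡ encode u′ v′ → u ≡ u′ × v ≡ v′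
  encode-injective u u′ v v′ eq = ++-injective u u′ (++-injectiveˡ (u ++ v) (u′ ++ v′) eq)

  encode-𝟎 : encode 𝟎 𝟎 ≡ 𝟎
  encode-𝟎 = begin
    (𝟎 {a} ++ 𝟎 {b}) ++ (replicate a (π (𝟎 {b})) ++ replicate b (π (𝟎 {a})))
      ≡⟨ cong₂ (λ x y → (𝟎 {a} ++ 𝟎 {b}) ++ (replicate a x ++ replicate b y)) (π-𝟎 b) (π-𝟎 a) ⟩
    (𝟎 {a} ++ 𝟎 {b}) ++ (𝟎 {a} ++ 𝟎 {b})
      ≡⟨ cong₂ _++_ (𝟎-++-𝟎 a) (𝟎-++-𝟎 a) ⟩
    𝟎 {a + b} ++ 𝟎 {a + b}
      ≡⟨ 𝟎-++-𝟎 (a + b) ⟩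
    𝟎 ∎

  encode-mono : {u u′ : Word a} {v v′ : Word b} →
                u′ ⊴ u → v′ ⊴ v → encode u′ v′ ≼ encode u v
  encode-mono (u′≼u , πu′≤πu) (v′≼v , πv′≤πv) =
    Pointwise.++⁺ (Pointwise.++⁺ u′≼u v′≼v)
                  (Pointwise.++⁺ (replicate-mono {m = a} πv′≤πv) (replicate-mono {m = b} πu′≤πu))

  -- Positivity of a and b matters here: the parity of v is recorded only in the a
  -- check coordinates of the first class, that of u only in the b of the second.
  encode-mono⁻ : .{{_ : NonZero a}} → .{{_ : NonZero b}} → {u u′ : Word a} {v v′ : Word b} →
                 encode u′ v′ ≼ encode u v → u′ ⊴ u × v′ ⊴ v
  encode-mono⁻ {u} {u′} {v} {v′} p =
    let messages , checks = Pointwise.++⁻ (u′ ++ v′) (u ++ v) p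
        u′≼u , v′≼v       = Pointwise.++⁻ u′ u messages
        onA , onB         = Pointwise.++⁻ (replicate a (π v′)) (replicate a (π v)) checks
    in  (u′≼u , replicate-mono⁻ onB) , (v′≼v , replicate-mono⁻ onA)

  ----------------------------------------------------------------------
  -- Minimal codewords

  private
    G : Matrix (a + b) ((a + b) + (a + b))
    G = [I∣A] (K a b)

  encode∈Code : (u : Word a) (v : Word b) → encode u v ∈Code G
  encode∈Code u v = u ++ v , sym (combination-K u v)

  encode-surjective : ∀ {c} → c ∈Code G → ∃ λ u → ∃ λ v → c ≡ encode u v
  encode-surjective (x , refl) with u , v , refl ← splitAt a x =
    u , v , combination-K u v

  encode≢𝟎 : {u : Word a} {v : Word b} → u ≢ 𝟎 ⊎ v ≢ 𝟎 → encode u v ≢ 𝟎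
  encode≢𝟎 {u} {v} u≢𝟎⊎v≢𝟎 eq
    with u≡𝟎 , v≡𝟎 ← encode-injective u 𝟎 v 𝟎 (trans eq (sym encode-𝟎)) with u≢𝟎⊎v≢𝟎
  ... | inj₁ u≢𝟎 = u≢𝟎 u≡𝟎
  ... | inj₂ v≢𝟎 = v≢𝟎 v≡𝟎

  -- One half of the message is zero and the other one is light; the two cases
  -- exclude each other.
  LightPair : Word a → Word b → Set
  LightPair u v = (Light u × v ≡ 𝟎) ⊎ (u ≡ 𝟎 × Light v)

  lightPair-minimal : {u u′ : Word a} {v v′ : Word b} → LightPair u v →
                      u′ ⊴ u → v′ ⊴ v → u′ ≢ 𝟎 ⊎ v′ ≢ 𝟎 → encode u′ v′ ≡ encode u v
  lightPair-minimal (inj₁ (light , refl)) u′⊴u (v′≼𝟎 , _) ≢𝟎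
    with refl ← ≼𝟎⇒≡𝟎 v′≼𝟎 with ≢𝟎
  ... | inj₁ u′≢𝟎 = cong (λ x → encode x 𝟎) (light-minimal light u′⊴u u′≢𝟎)
  ... | inj₂ 𝟎≢𝟎  = contradiction refl 𝟎≢𝟎
  lightPair-minimal (inj₂ (refl , light)) (u′≼𝟎 , _) v′⊴v ≢𝟎
    with refl ← ≼𝟎⇒≡𝟎 u′≼𝟎 with ≢𝟎
  ... | inj₁ 𝟎≢𝟎  = contradiction refl 𝟎≢𝟎
  ... | inj₂ v′≢𝟎 = cong (encode 𝟎) (light-minimal light v′⊴v v′≢𝟎)

  lightPair⇒≢𝟎 : {u : Word a} {v : Word b} → LightPair u v → u ≢ 𝟎 ⊎ v ≢ 𝟎
  lightPair⇒≢𝟎 (inj₁ (light , _)) = inj₁ (light⇒≢𝟎 light)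
  lightPair⇒≢𝟎 (inj₂ (_ , light)) = inj₂ (light⇒≢𝟎 light)

  nonzero-half : (u : Word a) (v : Word b) → encode u v ≢ 𝟎 → u ≢ 𝟎 ⊎ v ≢ 𝟎
  nonzero-half u v ≢𝟎 with u ≟ʷ 𝟎 | v ≟ʷ 𝟎
  ... | no  u≢𝟎  | _        = inj₁ u≢𝟎
  ... | yes _    | no  v≢𝟎  = inj₂ v≢𝟎
  ... | yes refl | yes refl = contradiction encode-𝟎 ≢𝟎

  lightPair-below : {u : Word a} {v : Word b} → u ≢ 𝟎 ⊎ v ≢ 𝟎 →
                    ∃ λ u′ → ∃ λ v′ → LightPair u′ v′ × u′ ⊴ u × v′ ⊴ v
  lightPair-below (inj₁ u≢𝟎) =
    let u′ , light , u′⊴u = light-below u≢𝟎 in u′ , 𝟎 , inj₁ (light , refl) , u′⊴u , 𝟎-⊴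
  lightPair-below (inj₂ v≢𝟎) =
    let v′ , light , v′⊴v = light-below v≢𝟎 in 𝟎 , v′ , inj₂ (refl , light) , 𝟎-⊴ , v′⊴v

  lightPair⇒minimal : .{{_ : NonZero a}} → .{{_ : NonZero b}} → {u : Word a} {v : Word b} →
                      LightPair u v → Minimal G (encode u v)
  lightPair⇒minimal {u} {v} lp =
    (encode∈Code u v , encode≢𝟎 (lightPair⇒≢𝟎 lp)) , noneBelow
    where
    noneBelow : ¬ ∃ λ c → NonzeroCodeword G c × supp c ⊂ supp (encode u v)
    noneBelow (c , (c∈Code , c≢𝟎) , c⊂) with u′ , v′ , refl ← encode-surjective c∈Code =
      let u′⊴u , v′⊴v = encode-mono⁻ (supp⊆⇒≼ _ _ (proj₁ c⊂))
          eq = lightPair-minimal lp u′⊴u v′⊴v (nonzero-half u′ v′ c≢𝟎)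
      in  ⊂-irref (cong supp eq) c⊂

  minimal⇒lightPair : ∀ {c} → Minimal G c → ∃ λ u → ∃ λ v → LightPair u v × c ≡ encode u v
  minimal⇒lightPair ((c∈Code , c≢𝟎) , noneBelow)
    with u , v , refl ← encode-surjective c∈Code
    with u′ , v′ , lp , u′⊴u , v′⊴v ← lightPair-below (nonzero-half u v c≢𝟎)
    with encode u′ v′ ≟ʷ encode u v
  ... | yes eq = u′ , v′ , lp , sym eq
  ... | no neq = contradiction
    (encode u′ v′ , (encode∈Code u′ v′ , encode≢𝟎 (lightPair⇒≢𝟎 lp)) ,
      ≼∧≢⇒supp⊂ (encode-mono u′⊴u v′⊴v) neq)
    noneBelow

  -- For positive a and b, all minimal codewords, each listed once.
  minimalWords : List (Word ((a + b) + (a + b)))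
  minimalWords = List.map (λ u → encode u 𝟎) (lights a) List.++ List.map (encode 𝟎) (lights b)

  unique-minimalWords : Unique minimalWords
  unique-minimalWords = Unique.++⁺
    (Unique.map⁺ (proj₁ ∘ encode-injective _ _ 𝟎 𝟎) (unique-lights a))
    (Unique.map⁺ (proj₂ ∘ encode-injective 𝟎 𝟎 _ _) (unique-lights b))
    λ (c∈₁ , c∈₂) → disjoint (∈-map⁻ _ c∈₁) (∈-map⁻ _ c∈₂)
    where
    disjoint : ∀ {c} → (∃ λ u → u ∈ lights a × c ≡ encode u 𝟎) →
               ¬ (∃ λ v → v ∈ lights b × c ≡ encode 𝟎 v)
    disjoint (u , u∈ , refl) (v , _ , eq) =
      light⇒≢𝟎 (∈-lights⁻ u∈) (proj₁ (encode-injective u 𝟎 𝟎 v eq))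

  ∈-minimalWords⁺ : {u : Word a} {v : Word b} → LightPair u v → encode u v ∈ minimalWords
  ∈-minimalWords⁺ {u} (inj₁ (light , refl)) = ∈-++⁺ˡ (∈-map⁺ (λ x → encode x 𝟎) (∈-lights⁺ {w = u} light))
  ∈-minimalWords⁺ (inj₂ (refl , light)) =
    ∈-++⁺ʳ (List.map (λ u → encode u 𝟎) (lights a)) (∈-map⁺ (encode 𝟎) (∈-lights⁺ light))

  ∈-minimalWords⁻ : ∀ {c} → c ∈ minimalWords → ∃ λ u → ∃ λ v → LightPair u v × c ≡ encode u v
  ∈-minimalWords⁻ c∈ with ∈-++⁻ (List.map (λ u → encode u 𝟎) (lights a)) c∈
  ... | inj₁ c∈₁ = let u , u∈ , eq = ∈-map⁻ _ c∈₁ in u , 𝟎 , inj₁ (∈-lights⁻ u∈ , refl) , eq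
  ... | inj₂ c∈₂ = let v , v∈ , eq = ∈-map⁻ _ c∈₂ in 𝟎 , v , inj₂ (refl , ∈-lights⁻ v∈) , eq

  M-K : .{{_ : NonZero a}} → .{{_ : NonZero b}} → M (K a b) ≡ length minimalWords
  M-K = ↭-length (∼bag⇒↭ (unique∧set⇒bag
    (Unique.filter⁺ (minimal? G) (words-unique _)) unique-minimalWords (mk⇔ to from)))
    where
    to : ∀ {c} → c ∈ filter (minimal? G) (words _) → c ∈ minimalWords
    to c∈ with u , v , lp , refl ← minimal⇒lightPair (proj₂ (∈-filter⁻ (minimal? G) {xs = words _} c∈)) =
      ∈-minimalWords⁺ lp

    from : ∀ {c} → c ∈ minimalWords → c ∈ filter (minimal? G) (words _)
    from c∈ with u , v , lp , refl ← ∈-minimalWords⁻ c∈ =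
      ∈-filter⁺ (minimal? G) (words-complete _) (lightPair⇒minimal lp)

proposition3p2 : (a b : ℕ) → .{{_ : NonZero a}} → .{{_ : NonZero b}} → M (K a b) ≡ a + b + (a C 2) + (b C 2)
proposition3p2 a b = begin
  M (K a b)
    ≡⟨ M-K a b ⟩
  length (minimalWords a b)
    ≡⟨ length-++ (List.map (λ u → encode a b u 𝟎) (lights a)) ⟩
  length (List.map (λ u → encode a b u 𝟎) (lights a)) + length (List.map (encode a b 𝟎) (lights b))
    ≡⟨ cong₂ _+_ (length-map _ (lights a)) (length-map _ (lights b)) ⟩
  length (lights a) + length (lights b)
    ≡⟨ cong₂ _+_ (length-lights a) (length-lights b) ⟩
  (a + a C 2) + (b + b C 2)
    ≡⟨ interchange ℕ.+-commutativeSemigroup a (a C 2) b (b C 2) ⟩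
  (a + b) + (a C 2 + b C 2)
    ≡⟨ ℕ.+-assoc (a + b) (a C 2) (b C 2) ⟨
  a + b + (a C 2) + (b C 2) ∎
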